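{- For all positive integers $k,n$, $Z_{\mathsf{GIG}}(n;k) \le 54n(k-1)$.
   Context: A bipartite graph $G=(U\cup V,E)$ is a grid intersection graph (class $\mathsf{GIG}$) if there is a map sending each vertex of $U$ to a horizontal segment in $\mathbb{R}^2$ and each vertex of $V$ to a vertical segment in $\mathbb{R}^2$ such that $u\in U$ and $v\in V$ are adjacent iff their segments intersect. For a class $\mathcal{C}$ of bipartite graphs, $Z_{\mathcal{C}}(n;k)$ is the maximum number of edges of a graph $G=(U\cup V,E)\in\mathcal{C}$ with $|U|=|V|=n$ that does not contain $K_{k,k}$ as a subgraph. -}

module Defs where

open import Level using (0ℓ) renaming (suc to lsuc)
open import Data.Nat using (ℕ; _+_)
open import Data.Bool using (Bool; true; false)
open import Data.Fin using (Fin)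
open import Data.List using (List; map; allFin)
open import Data.Nat.ListAction using (sum)
open import Data.Product using (Σ; _×_; _,_; ∃)
open import Relation.Binary.PropositionalEquality using (_≡_)
open import Relation.Binary.Bundles using (TotalOrder)
open import Function.Definitions using (Injective)
open import Function.Bundles using (_⇔_)

-- A bipartite graph G = (U ∪ V, E) with U = V = Fin n (as abstract index sets),
-- given by its biadjacency relation: u ∈ U adjacent to v ∈ V iff adj u v ≡ true.
BipGraph : ℕ → Set
BipGraph n = Fin n → Fin n → Bool

b2n : Bool → ℕ
b2n true  = 1
b2n false = 0

edgeCount : ∀ {n} → BipGraph n → ℕ
edgeCount {n} adj = sum (map (λ u → sum (map (λ v → b2n (adj u v)) (allFin n))) (allFin n))

ContainsKkk : ∀ {n} → ℕ → BipGraph n → Set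
ContainsKkk {n} k adj =
  Σ (Fin k → Fin n) λ f → Σ (Fin k → Fin n) λ g →
    Injective _≡_ _≡_ f × Injective _≡_ _≡_ g × (∀ i j → adj (f i) (g j) ≡ true)

module Segments (C : TotalOrder 0ℓ 0ℓ 0ℓ) where
  open TotalOrder C renaming (Carrier to R)

  record HSeg : Set where
    field
      x₁ x₂ y : R
      ordered : x₁ ≤ x₂

  record VSeg : Set where
    field
      x y₁ y₂ : R
      ordered : y₁ ≤ y₂

  Intersect : HSeg → VSeg → Set
  Intersect h v = (H.x₁ ≤ V.x × V.x ≤ H.x₂) × (V.y₁ ≤ H.y × H.y ≤ V.y₂)
    where module H = HSeg h
          module V = VSeg v

-- G is a grid intersection graph: there is a coordinate line (a total order,
-- e.g. ℝ), horizontal segments for U and vertical segments for V such that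
-- u, v adjacent iff their segments intersect.
IsGIG : ∀ {n} → BipGraph n → Set₁
IsGIG {n} adj =
  Σ (TotalOrder 0ℓ 0ℓ 0ℓ) λ C → let open Segments C in
    Σ (Fin n → HSeg) λ h → Σ (Fin n → VSeg) λ v →
      ∀ u w → (adj u w ≡ true) ⇔ Intersect (h u) (v w)

{-# OPTIONS --safe #-}

-- Sort the coordinates and look at a crossing of a row h and a column v in a
-- family of rows R and columns C. Let w be the next column crossing h to the
-- right of v, and g the lowest row above h meeting the strip between v and w.
-- Either v, w, h, g bound a rectangle, or the crossing can be charged injectively
-- to h, v, w, or to an end of g. So all but 3|R| + 2|C| crossings are lower left
-- corners of rectangles whose sides are consecutive along h and along v.
-- If there is no K_{k,k}, then in such a rectangle w is among the first k − 1
-- columns after v that cross both h and g, or g among the first k − 1 rows above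
-- h that cross both v and w. Choosing rows and columns independently with
-- probability 1/q, the first event has conditional probability at most (k − 1)/q,
-- since g is determined by the chosen rows; likewise for the second. Hence the
-- number X of crossings of a rows and b columns satisfies
-- X/q² ≤ 2 (k − 1) X/q³ + (3a + 2b)/q, and q = 4 (k − 1) yields
-- X ≤ 8 (k − 1) (3a + 2b), which is 40 n (k − 1) for a = b = n.
module Submission where

open import Defs
open import Level using (0ℓ)
open import Data.Bool using (Bool; true; false; T)
open import Data.Fin as Fin using (Fin; zero; suc)
import Data.Fin.Properties as Fin
open import Data.List as List using (map; allFin)
open import Data.List.Properties using (map-tabulate)
open import Data.Nat
import Data.Nat.ListAction as ListAction
open import Data.Nat.Properties
open import Algebra.Properties.Semiring.Sum +-*-semiring
open import Data.Nat.Tactic.RingSolver using (solve-∀)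
open import Data.Product using (Σ; _×_; _,_; ∃; ∃₂; proj₁; proj₂; swap)
open import Data.Sum using (_⊎_; inj₁; inj₂; reduce)
open import Data.Vec.Functional using ([]; _∷_)
open import Function using (_∘_; id)
open import Function.Bundles using (_⇔_; mk⇔; Equivalence)
open import Function.Definitions using (Injective)
open import Relation.Binary using (tri<; tri≈; tri>; TotalOrder)
open import Relation.Binary.PropositionalEquality
open import Relation.Nullary
open import Relation.Nullary.Decidable using (T?; decidable-stable; ¬¬-excluded-middle)

-- Indicators, finite sums and counting.

𝟙 : {P : Set} → Dec P → ℕ
𝟙 p? = b2n (does p?)

private variable
  P Q M : Set
  l n : ℕ

𝟙-mono : (p? : Dec P) (q? : Dec Q) → (P → Q) → 𝟙 p? ≤ 𝟙 q?
𝟙-mono (yes p) (yes q) f = ≤-refl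
𝟙-mono (yes p) (no ¬q) f = contradiction (f p) ¬q
𝟙-mono (no ¬p) q?      f = z≤n

𝟙-⊎ : (p? : Dec P) (q? : Dec Q) → 𝟙 (p? ⊎-dec q?) ≤ 𝟙 p? + 𝟙 q?
𝟙-⊎ (yes p) q? = s≤s z≤n
𝟙-⊎ (no ¬p) q? = ≤-refl

𝟙-× : (p? : Dec P) (q? : Dec Q) → 𝟙 (p? ×-dec q?) ≡ 𝟙 p? * 𝟙 q?
𝟙-× (yes p) q? = sym (+-identityʳ _)
𝟙-× (no ¬p) q? = refl

𝟙-yes : (p? : Dec P) → P → 𝟙 p? ≡ 1
𝟙-yes (yes _) _ = refl
𝟙-yes (no ¬p) p = contradiction p ¬p

sum-mono : {f g : Fin n → ℕ} → (∀ i → f i ≤ g i) → sum f ≤ sum g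
sum-mono {zero}  f≤g = z≤n
sum-mono {suc n} f≤g = +-mono-≤ (f≤g zero) (sum-mono (f≤g ∘ suc))

term≤sum : (f : Fin n → ℕ) (i : Fin n) → f i ≤ sum f
term≤sum f zero    = m≤m+n _ _
term≤sum f (suc i) = ≤-trans (term≤sum (f ∘ suc) i) (m≤n+m _ _)

sum-allFin : (f : Fin n → ℕ) → ListAction.sum (map f (allFin n)) ≡ sum f
sum-allFin f = trans (cong ListAction.sum (map-tabulate id f)) (sum-tabulate f)
  where
  sum-tabulate : ∀ {n} (f : Fin n → ℕ) → ListAction.sum (List.tabulate f) ≡ sum f
  sum-tabulate {zero}  f = refl
  sum-tabulate {suc n} f = cong (f zero +_) (sum-tabulate (f ∘ suc))

sum-const : ∀ n c → ∑[ i < n ] c ≡ n * c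
sum-const zero    c = refl
sum-const (suc n) c = cong (c +_) (sum-const n c)

*-distribˡ-sum₂ : ∀ s (f : Fin l → Fin n → ℕ) →
  s * sum (λ i → sum (f i)) ≡ sum (λ i → sum λ j → s * f i j)
*-distribˡ-sum₂ s f = trans (*-distribˡ-sum s (λ i → sum (f i)))
                            (sum-cong-≗ λ i → *-distribˡ-sum s (f i))

sum-cong₂ : ∀ {f g : Fin l → Fin n → ℕ} → (∀ i j → f i j ≡ g i j) →
  sum (λ i → sum (f i)) ≡ sum (λ i → sum (g i))
sum-cong₂ f≡g = sum-cong-≗ λ i → sum-cong-≗ (f≡g i)

count : {P : Fin n → Set} → (∀ i → Dec (P i)) → ℕ
count P? = sum (λ i → 𝟙 (P? i))

count₂ : {P : Fin l → Fin n → Set} → (∀ i j → Dec (P i j)) → ℕ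
count₂ P? = sum (λ i → count (P? i))

count-mono : {P Q : Fin n → Set} (P? : ∀ i → Dec (P i)) (Q? : ∀ i → Dec (Q i)) →
  (∀ i → P i → Q i) → count P? ≤ count Q?
count-mono P? Q? P⇒Q = sum-mono λ i → 𝟙-mono (P? i) (Q? i) (P⇒Q i)

count-mono-< : {P Q : Fin n → Set} (P? : ∀ i → Dec (P i)) (Q? : ∀ i → Dec (Q i)) →
  (∀ i → P i → Q i) → ∀ j → Q j → ¬ P j → count P? < count Q?
count-mono-< P? Q? P⇒Q zero qj ¬pj with P? zero | Q? zero
... | yes p | _     = contradiction p ¬pj
... | no _  | no ¬q = contradiction qj ¬q
... | no _  | yes _ = s≤s (count-mono (P? ∘ suc) (Q? ∘ suc) (P⇒Q ∘ suc))
count-mono-< P? Q? P⇒Q (suc j) qj ¬pj =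
  +-mono-≤-< (𝟙-mono (P? zero) (Q? zero) (P⇒Q zero))
             (count-mono-< (P? ∘ suc) (Q? ∘ suc) (P⇒Q ∘ suc) j qj ¬pj)

count₂-mono : {P Q : Fin l → Fin n → Set}
  (P? : ∀ i j → Dec (P i j)) (Q? : ∀ i j → Dec (Q i j)) →
  (∀ i j → P i j → Q i j) → count₂ P? ≤ count₂ Q?
count₂-mono P? Q? P⇒Q = sum-mono λ i → count-mono (P? i) (Q? i) (P⇒Q i)

count₂-⊎ : {P Q : Fin l → Fin n → Set}
  (P? : ∀ i j → Dec (P i j)) (Q? : ∀ i j → Dec (Q i j)) →
  count₂ (λ i j → P? i j ⊎-dec Q? i j) ≤ count₂ P? + count₂ Q?
count₂-⊎ P? Q? = begin
  count₂ (λ i j → P? i j ⊎-dec Q? i j)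
    ≤⟨ sum-mono (λ i → sum-mono λ j → 𝟙-⊎ (P? i j) (Q? i j)) ⟩
  sum (λ i → sum (λ j → 𝟙 (P? i j) + 𝟙 (Q? i j)))
    ≡⟨ sum-cong-≗ (λ i → ∑-distrib-+ (λ j → 𝟙 (P? i j)) _) ⟩
  sum (λ i → count (P? i) + count (Q? i))
    ≡⟨ ∑-distrib-+ (λ i → count (P? i)) _ ⟩
  count₂ P? + count₂ Q? ∎
  where open ≤-Reasoning

-- Once `zero` satisfies `P`, nothing in the tail does. That is the same statement with the empty
-- type for `M`, whose decision `no id` has indicator 0.
count-unique : {P : Fin n → Set} (P? : ∀ i → Dec (P i)) (m? : Dec M) →
  (∀ i → P i → M) → (∀ i j → P i → P j → i ≡ j) → count P? ≤ 𝟙 m?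
count-unique {zero}  P? m? P⇒M unique = z≤n
count-unique {suc n} P? m? P⇒M unique with P? zero
... | no _  = count-unique (P? ∘ suc) m? (P⇒M ∘ suc)
                λ i j pi pj → Fin.suc-injective (unique _ _ pi pj)
... | yes p = begin
  1 + count (P? ∘ suc)  ≤⟨ s≤s (count-unique (P? ∘ suc) (no id)
                             (λ i pi → Fin.0≢1+n (unique _ _ p pi))
                             (λ i j pi pj → Fin.suc-injective (unique _ _ pi pj))) ⟩
  1                     ≡⟨ 𝟙-yes m? (P⇒M zero p) ⟨
  𝟙 m?                  ∎
  where open ≤-Reasoning

𝟙-any : {P : Fin n → Set} (P? : ∀ i → Dec (P i)) → 𝟙 (Fin.any? P?) ≤ count P?
𝟙-any P? with Fin.any? P?
... | no _        = z≤n
... | yes (i , p) = ≤-trans (≤-reflexive (sym (𝟙-yes (P? i) p))) (term≤sum _ i)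

-- Double counting: a pair counted on the left is related to at least one `t`, and each `t` to at
-- most one pair, so it suffices to sum over `t` last.
charge : ∀ {a b c} {R : Fin a → Fin b → Fin c → Set} (R? : ∀ i j t → Dec (R i j t))
  {M : Fin c → Set} (M? : ∀ t → Dec (M t)) → (∀ {i j t} → R i j t → M t) →
  (∀ {i j i′ j′ t} → R i j t → R i′ j′ t → i ≡ i′ × j ≡ j′) →
  count₂ (λ i j → Fin.any? (R? i j)) ≤ count M?
charge {a} {b} {c} R? M? R⇒M unique = begin
  count₂ (λ i j → Fin.any? (R? i j))
    ≤⟨ sum-mono (λ i → sum-mono λ j → 𝟙-any (R? i j)) ⟩
  sum (λ i → sum (λ j → sum (λ t → 𝟙 (R? i j t))))
    ≡⟨ sum-cong-≗ (λ i → ∑-comm (λ j t → 𝟙 (R? i j t))) ⟩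
  sum (λ i → sum (λ t → sum (λ j → 𝟙 (R? i j t))))
    ≡⟨ ∑-comm (λ i t → sum (λ j → 𝟙 (R? i j t))) ⟩
  sum (λ t → sum (λ i → sum (λ j → 𝟙 (R? i j t))))
    ≤⟨ sum-mono (λ t → ≤-trans
         (sum-mono λ i → count-unique (λ j → R? i j t) (Fin.any? λ j → R? i j t)
           (λ j r → j , r) (λ j j′ r r′ → proj₂ (unique r r′)))
         (count-unique (λ i → Fin.any? λ j → R? i j t) (M? t)
           (λ i (j , r) → R⇒M r) (λ i i′ (_ , r) (_ , r′) → proj₁ (unique r r′)))) ⟩
  count M? ∎
  where
  open ≤-Reasoning

-- Extremal elements, ranks and selection.

extremum : {_≲_ : ℕ → ℕ → Set} → (∀ a b → a ≲ b ⊎ b ≲ a) → (∀ {a b c} → a ≲ b → b ≲ c → a ≲ c) →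
  (f : Fin n → ℕ) {P : Fin n → Set} → (∀ i → Dec (P i)) →
  (∀ i → ¬ P i) ⊎ (∃ λ i → P i × (∀ j → P j → f i ≲ f j))
extremum {zero}  total ≲-trans f P? = inj₁ λ ()
extremum {suc n} {_≲_} total ≲-trans f {P} P?
  with P? zero | extremum {_≲_ = _≲_} total ≲-trans (f ∘ suc) (P? ∘ suc)
... | no ¬p | inj₁ none = inj₁ λ { zero → ¬p ; (suc i) → none i }
... | no ¬p | inj₂ (i , pi , least) =
  inj₂ (suc i , pi , λ { zero p → contradiction p ¬p ; (suc j) → least j })
... | yes p | inj₁ none =
  -- Totality at equal arguments supplies reflexivity.
  inj₂ (zero , p , λ { zero _ → reduce (total (f zero) (f zero))
                     ; (suc j) pj → contradiction pj (none j) })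
... | yes p | inj₂ (i , pi , least) with total (f zero) (f (suc i))
...   | inj₁ 0≲i = inj₂ (zero , p , λ { zero _ → reduce (total (f zero) (f zero))
                                     ; (suc j) pj → ≲-trans 0≲i (least j pj) })
...   | inj₂ i≲0 = inj₂ (suc i , pi , λ { zero _ → i≲0 ; (suc j) → least j })

argmin : (f : Fin n → ℕ) {P : Fin n → Set} → (∀ i → Dec (P i)) →
  (∀ i → ¬ P i) ⊎ (∃ λ i → P i × (∀ j → P j → f i ≤ f j))
argmin = extremum ≤-total ≤-trans

argmax : (f : Fin n → ℕ) {P : Fin n → Set} → (∀ i → Dec (P i)) →
  (∀ i → ¬ P i) ⊎ (∃ λ i → P i × (∀ j → P j → f j ≤ f i))
argmax = extremum (λ a b → ≤-total b a) (λ p q → ≤-trans q p)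

-- Take the greatest element of rank at most `m`: all the others lie among the at most `m` elements
-- up to it.
count-low-rank : (x : Fin n → ℕ) {P : Fin n → Set} (P? : ∀ i → Dec (P i)) (m : ℕ) →
  count (λ i → P? i ×-dec count (λ j → P? j ×-dec x j ≤? x i) ≤? m) ≤ m
count-low-rank x P? m = bound (argmax x low?)
  where
  below? = λ i j → P? j ×-dec x j ≤? x i
  low?   = λ i → P? i ×-dec count (below? i) ≤? m
  bound : _ → count low? ≤ m
  bound (inj₁ none) =
    ≤-trans (count-unique low? (no id) none λ i _ q _ → contradiction q (none i)) z≤n
  bound (inj₂ (i , (_ , rank≤m) , greatest)) =
    ≤-trans (count-mono low? (below? i) λ j q → proj₁ q , greatest j q) rank≤m

count⇒injection : (k : ℕ) {P : Fin n → Set} (P? : ∀ i → Dec (P i)) → k ≤ count P? →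
  Σ (Fin k → Fin n) λ f → Injective _≡_ _≡_ f × (∀ i → P (f i))
count⇒injection zero P? _ = (λ ()) , (λ { {()} }) , λ ()
count⇒injection {suc n} (suc k) P? k≤ with P? zero
... | no _ with f , inj , all ← count⇒injection (suc k) (P? ∘ suc) k≤ =
  suc ∘ f , inj ∘ Fin.suc-injective , all
... | yes p with f , inj , all ← count⇒injection k (P? ∘ suc) (s≤s⁻¹ k≤) =
  zero ∷ (suc ∘ f)
  , (λ { {zero} {zero} _ → refl
       ; {suc i} {suc j} eq → cong suc (inj (Fin.suc-injective eq)) })
  , λ { zero → p ; (suc i) → all i }

-- Weighted sums over random subsets.

-- E f is the sum of f S over all subsets S of Fin n, weighted by
-- (q ∸ 1) ^ (number of absent elements): it is q ^ n times the expectation of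
-- f over a random subset containing every element with probability 1 / q.
module Sampling (p : ℕ) where
  q : ℕ
  q = suc p

  E : ∀ n → ((Fin n → Bool) → ℕ) → ℕ
  E zero    f = f []
  E (suc n) f = E n (λ S → f (true ∷ S)) + p * E n (λ S → f (false ∷ S))

  E-mono : ∀ n {f g} → (∀ S → f S ≤ g S) → E n f ≤ E n g
  E-mono zero    f≤g = f≤g []
  E-mono (suc n) f≤g = +-mono-≤ (E-mono n λ S → f≤g (true ∷ S))
                                (*-monoʳ-≤ p (E-mono n λ S → f≤g (false ∷ S)))

  E-cong : ∀ n {f g} → (∀ S → f S ≡ g S) → E n f ≡ E n g
  E-cong n f≡g = ≤-antisym (E-mono n λ S → ≤-reflexive (f≡g S))
                           (E-mono n λ S → ≤-reflexive (sym (f≡g S)))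

  E-+ : ∀ n f g → E n (λ S → f S + g S) ≡ E n f + E n g
  E-+ zero    f g = refl
  E-+ (suc n) f g =
    trans (cong₂ (λ a b → a + p * b) (E-+ n (f ∘ (true ∷_)) (g ∘ (true ∷_)))
                                     (E-+ n (f ∘ (false ∷_)) (g ∘ (false ∷_))))
          (rearrange (E n (f ∘ (true ∷_))) (E n (g ∘ (true ∷_))) _ _ p)
    where
    rearrange : ∀ a b c d p → (a + b) + p * (c + d) ≡ (a + p * c) + (b + p * d)
    rearrange = solve-∀

  E-* : ∀ n c f → E n (λ S → c * f S) ≡ c * E n f
  E-* zero    c f = refl
  E-* (suc n) c f =
    trans (cong₂ (λ a b → a + p * b) (E-* n c _) (E-* n c _))
          (rearrange c (E n (f ∘ (true ∷_))) _ p)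
    where
    rearrange : ∀ c a b p → c * a + p * (c * b) ≡ c * (a + p * b)
    rearrange = solve-∀

  E-const : ∀ n c → E n (λ _ → c) ≡ c * q ^ n
  E-const zero    c = sym (*-identityʳ c)
  E-const (suc n) c =
    trans (cong₂ (λ a b → a + p * b) (E-const n c) (E-const n c)) (rearrange c (q ^ n) p)
    where
    rearrange : ∀ c t p → c * t + p * (c * t) ≡ c * (t + p * t)
    rearrange = solve-∀

  E-sum : ∀ n (f : (Fin n → Bool) → Fin l → ℕ) →
    E n (λ S → sum (f S)) ≡ sum (λ i → E n (λ S → f S i))
  E-sum {zero}  n f = E-const n 0
  E-sum {suc l} n f = trans (E-+ n _ _) (cong₂ _+_ refl (E-sum n (λ S i → f S (suc i))))

  E-comm : ∀ m n (f : (Fin m → Bool) → (Fin n → Bool) → ℕ) →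
    E m (λ S → E n (λ T → f S T)) ≡ E n (λ T → E m (λ S → f S T))
  E-comm zero    n f = refl
  E-comm (suc m) n f = begin
    E m (λ S → E n (f (true ∷ S))) + p * E m (λ S → E n (f (false ∷ S)))
      ≡⟨ cong₂ (λ a b → a + p * b) (E-comm m n _) (E-comm m n _) ⟩
    E n (λ T → E m (λ S → f (true ∷ S) T)) + p * E n (λ T → E m (λ S → f (false ∷ S) T))
      ≡⟨ cong₂ _+_ refl (E-* n p _) ⟨
    E n (λ T → E m (λ S → f (true ∷ S) T)) + E n (λ T → p * E m (λ S → f (false ∷ S) T))
      ≡⟨ E-+ n _ _ ⟨
    E n (λ T → E m (λ S → f (true ∷ S) T) + p * E m (λ S → f (false ∷ S) T)) ∎
    where open ≡-Reasoning

  -- Membership has probability 1 / `q` and the total weight is `q ^ n`; denominators are cleared to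
  -- stay in ℕ.
  E-∈ : ∀ n i → q * E n (λ S → b2n (S i)) ≡ q ^ n
  E-∈ (suc n) zero =
    trans (cong₂ (λ a b → q * (a + p * b)) (E-const n 1) (E-const n 0)) (rearrange (q ^ n) p)
    where
    rearrange : ∀ t p → suc p * (1 * t + p * 0) ≡ suc p * t
    rearrange = solve-∀
  E-∈ (suc n) (suc i) = cong (q *_) (E-∈ n i)

  -- Memberships of distinct elements are independent: the first choice that concerns one of them
  -- leaves the other to `E-∈`.
  E-∈₂ : ∀ n {i j} → i ≢ j → q * q * E n (λ S → b2n (S i) * b2n (S j)) ≡ q ^ n
  E-∈₂ (suc n) {zero}  {zero}  i≢j = contradiction refl i≢j
  E-∈₂ (suc n) {zero}  {suc j} i≢j = begin
    q * q * (E n (λ S → 1 * b2n (S j)) + p * E n (λ S → 0))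
      ≡⟨ cong₂ (λ a b → q * q * (a + p * b)) (E-* n 1 _) (E-const n 0) ⟩
    q * q * (1 * E n (λ S → b2n (S j)) + p * 0)
      ≡⟨ rearrange _ p ⟩
    q * (q * E n (λ S → b2n (S j)))
      ≡⟨ cong (q *_) (E-∈ n j) ⟩
    q * q ^ n ∎
    where
    open ≡-Reasoning
    rearrange : ∀ t p → suc p * suc p * (1 * t + p * 0) ≡ suc p * (suc p * t)
    rearrange = solve-∀
  E-∈₂ (suc n) {suc i} {zero}  i≢j =
    trans (cong (λ e → q * q * e) (E-cong (suc n) λ S → *-comm (b2n (S (suc i))) (b2n (S zero))))
          (E-∈₂ (suc n) (i≢j ∘ sym))
  E-∈₂ (suc n) {suc i} {suc j} i≢j = begin
    q * q * (e + p * e)  ≡⟨ rearrange e p ⟩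
    q * (q * q * e)      ≡⟨ cong (q *_) (E-∈₂ n (i≢j ∘ cong suc)) ⟩
    q * q ^ n            ∎
    where
    open ≡-Reasoning
    e = E n (λ S → b2n (S i) * b2n (S j))
    rearrange : ∀ e p → suc p * suc p * (e + p * e) ≡ suc p * (suc p * suc p * e)
    rearrange = solve-∀

-- Combinatorial grid representations.

-- One coordinate of the picture: `b` points, where the segments perpendicular to the axis sit, and
-- `a` intervals, the projections of the segments parallel to it. Distinct positions make "next" and
-- "topmost" unique.
record Axis (a b : ℕ) : Set where
  field
    pos     : Fin b → ℕ
    pos-inj : ∀ {v w} → pos v ≡ pos w → v ≡ w
    lo hi   : Fin a → ℕ

  -- Half-open, so that segments meeting no column have a representation too.
  Covers : Fin a → Fin b → Set
  Covers h v = lo h ≤ pos v × pos v < hi h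

  covers? : ∀ h v → Dec (Covers h v)
  covers? h v = lo h ≤? pos v ×-dec pos v <? hi h

-- Rows are a horizontal segments and columns b vertical segments: X records the
-- abscissae and Y the ordinates, so that Grid Y X is the reflection of Grid X Y
-- in the diagonal.
module Grid {a b} (X : Axis a b) (Y : Axis b a) where
  open Axis Y using () renaming (pos to y)

  Cross : Fin a → Fin b → Set
  Cross h v = Axis.Covers X h v × Axis.Covers Y v h

  cross? : ∀ h v → Dec (Cross h v)
  cross? h v = Axis.covers? X h v ×-dec Axis.covers? Y v h

  NextRow : (Fin a → Bool) → Fin a → Fin b → Fin a → Set
  NextRow R h v g = (T (R g) × Cross g v × y h < y g) ×
    (∀ g′ → T (R g′) × Cross g′ v × y h < y g′ → y g ≤ y g′)

  above? : ∀ (R : Fin a → Bool) h v g → Dec (T (R g) × Cross g v × y h < y g)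
  above? R h v g = T? (R g) ×-dec cross? g v ×-dec y h <? y g

  nextRow? : ∀ R h v g → Dec (NextRow R h v g)
  nextRow? R h v g = above? R h v g ×-dec
    Fin.all? λ g′ → above? R h v g′ →-dec y g ≤? y g′

  nextRow-unique : ∀ {R h v g g′} → NextRow R h v g → NextRow R h v g′ → g ≡ g′
  nextRow-unique (p , least) (p′ , least′) =
    Axis.pos-inj Y (≤-antisym (least _ p′) (least′ _ p))

  Top : (Fin a → Bool) → Fin a → Fin b → Set
  Top R h v = T (R h) × Cross h v × (∀ g → T (R g) × Cross g v → y g ≤ y h)

  top? : ∀ R h v → Dec (Top R h v)
  top? R h v = T? (R h) ×-dec cross? h v ×-dec
    Fin.all? λ g → (T? (R g) ×-dec cross? g v) →-dec y g ≤? y h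

  top-unique : ∀ {R h h′ v} → Top R h v → Top R h′ v → h ≡ h′
  top-unique (r , c , max) (r′ , c′ , max′) =
    Axis.pos-inj Y (≤-antisym (max′ _ (r , c)) (max _ (r′ , c′)))

-- Charging the crossings that start no rectangle.

module Sweep {a b} (X : Axis a b) (Y : Axis b a) (R : Fin a → Bool) (C : Fin b → Bool) where
  open Axis X using () renaming (pos to x; lo to left; hi to right)
  open Axis Y using () renaming (pos to y; hi to top)
  open Grid X Y
  module Flip = Grid Y X

  Edge : Fin a → Fin b → Set
  Edge h v = T (R h) × T (C v) × Cross h v

  edge? : ∀ h v → Dec (Edge h v)
  edge? h v = T? (R h) ×-dec T? (C v) ×-dec cross? h v

  NextUp : Fin a → Fin b → Fin a → Set
  NextUp = NextRow R

  NextRight : Fin a → Fin b → Fin b → Set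
  NextRight h v w = Flip.NextRow C v h w

  nextRight? : ∀ h v w → Dec (NextRight h v w)
  nextRight? h v w = Flip.nextRow? C v h w

  Rectangle : Fin a → Fin b → Fin a → Fin b → Set
  Rectangle h v g w = Edge h v × NextUp h v g × NextRight h v w × Cross g w

  rectangle? : ∀ h v g w → Dec (Rectangle h v g w)
  rectangle? h v g w =
    edge? h v ×-dec nextRow? R h v g ×-dec nextRight? h v w ×-dec cross? g w

  -- Were `v` to the left of `v′`, then `v′` would be a candidate for the column after `v`, and
  -- nearer than `w`.
  next-unique : ∀ {h v v′ w} → Edge h v → Edge h v′ → NextRight h v w → NextRight h v′ w → v ≡ v′
  next-unique {h} {v} {v′} (_ , cv , c) (_ , cv′ , c′) ((_ , _ , v<w) , least) ((_ , _ , v′<w) , least′)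
    with <-cmp (x v) (x v′)
  ... | tri< v<v′ _ _ = contradiction (least v′ (cv′ , swap c′ , v<v′)) (<⇒≱ v′<w)
  ... | tri≈ _ v≡v′ _ = Axis.pos-inj X v≡v′
  ... | tri> _ _ v′<v = contradiction (least′ v (cv , swap c , v′<v)) (<⇒≱ v<w)

  -- Only the horizontal extent of `g` is compared with the strip; the columns `v` and `w` may end
  -- below or above `g`.
  Meets : Fin b → Fin b → Fin a → Set
  Meets v w g = left g ≤ x w × x v < right g

  meets? : ∀ v w g → Dec (Meets v w g)
  meets? v w g = left g ≤? x w ×-dec x v <? right g

  -- In the relations from here to `EndInStrip` the last argument is the row or column to which the
  -- crossing of `h` and `v` is charged. Equations such as `t ≡ h` bring them into the form that
  -- `charge` takes.
  LastInRow : Fin a → Fin b → Fin a → Set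
  LastInRow h v t = t ≡ h × T (R h) × Flip.Top C v h

  TopOfColumn : Fin a → Fin b → Fin b → Set
  TopOfColumn h v t = t ≡ v × T (C v) × Top R h v

  TopOfNext : Fin a → Fin b → Fin b → Set
  TopOfNext h v t = Edge h v × NextRight h v t × Top R h t

  -- As segments are half-open, one test serves both ends: for `left` it says that `g` misses `v`
  -- horizontally, for `right` that `g` misses `w`.
  EndInStrip : (Fin a → ℕ) → Fin a → Fin b → Fin a → Set
  EndInStrip end h v g = Edge h v × (T (R g) × y h < y g) × ∃ λ w → NextRight h v w ×
    (x v < end g × end g ≤ x w) ×
    (∀ g′ → T (R g′) × y h < y g′ × Meets v w g′ → y g ≤ y g′)

  lastInRow? : ∀ h v t → Dec (LastInRow h v t)
  lastInRow? h v t = t Fin.≟ h ×-dec T? (R h) ×-dec Flip.top? C v h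

  topOfColumn? : ∀ h v t → Dec (TopOfColumn h v t)
  topOfColumn? h v t = t Fin.≟ v ×-dec T? (C v) ×-dec top? R h v

  topOfNext? : ∀ h v t → Dec (TopOfNext h v t)
  topOfNext? h v t = edge? h v ×-dec nextRight? h v t ×-dec top? R h t

  endInStrip? : ∀ end h v g → Dec (EndInStrip end h v g)
  endInStrip? end h v g = edge? h v ×-dec (T? (R g) ×-dec y h <? y g) ×-dec
    Fin.any? λ w → nextRight? h v w ×-dec (x v <? end g ×-dec end g ≤? x w) ×-dec
    Fin.all? λ g′ → (T? (R g′) ×-dec y h <? y g′ ×-dec meets? v w g′) →-dec y g ≤? y g′

  lastInRow-unique : ∀ {h v h′ v′ t} → LastInRow h v t → LastInRow h′ v′ t → h ≡ h′ × v ≡ v′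
  lastInRow-unique (refl , _ , l) (refl , _ , l′) = refl , Flip.top-unique l l′

  topOfColumn-unique : ∀ {h v h′ v′ t} → TopOfColumn h v t → TopOfColumn h′ v′ t → h ≡ h′ × v ≡ v′
  topOfColumn-unique (refl , _ , l) (refl , _ , l′) = top-unique l l′ , refl

  -- The column `t` determines `h` as its topmost row, and then `v` as its predecessor along `h`.
  topOfNext-unique : ∀ {h v h′ v′ t} → TopOfNext h v t → TopOfNext h′ v′ t → h ≡ h′ × v ≡ v′
  topOfNext-unique (e , next , l) (e′ , next′ , l′) with refl ← top-unique l l′ =
    refl , next-unique e e′ next next′

  -- A row h′ strictly between h and g whose own strip contains end g passes
  -- through the strip of h, contrary to g being the lowest such row.
  endInStrip-unique-row : ∀ end {h v h′ v′ g} →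
    EndInStrip end h v g → EndInStrip end h′ v′ g → ¬ y h < y h′
  endInStrip-unique-row end {h′ = h′}
    (_ , _ , _ , _ , (v<e , e≤w) , lowest)
    ((r , _ , ((left≤v′ , _) , _)) , (_ , h′<g) , _ , ((_ , (_ , (_ , w′<right)) , _) , _) , (v′<e , e≤w′) , _) h<h′ =
    <⇒≱ h′<g (lowest h′ (r , h<h′ ,
      ≤-trans left≤v′ (<⇒≤ (<-≤-trans v′<e e≤w)) , <-trans (<-≤-trans v<e e≤w′) w′<right))

  -- Once the rows agree, the strips between consecutive columns along that row are disjoint, so
  -- `end g` lies in only one of them.
  endInStrip-unique : ∀ end {h v h′ v′ g} →
    EndInStrip end h v g → EndInStrip end h′ v′ g → h ≡ h′ × v ≡ v′
  endInStrip-unique end {h = h} {v} {h′} {v′} s s′ with <-cmp (y h) (y h′)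
  ... | tri< h<h′ _ _ = contradiction h<h′ (endInStrip-unique-row end s s′)
  ... | tri> _ _ h′<h = contradiction h′<h (endInStrip-unique-row end s′ s)
  ... | tri≈ _ h≡h′ _ with refl ← Axis.pos-inj Y h≡h′
    with (_ , cv , c) , _ , _ , (_ , least) , (v<e , e≤w) , _ ← s
       | (_ , cv′ , c′) , _ , _ , (_ , least′) , (v′<e , e≤w′) , _ ← s′
    with <-cmp (x v) (x v′)
  ... | tri< v<v′ _ _ = contradiction (least v′ (cv′ , swap c′ , v<v′)) (<⇒≱ (<-≤-trans v′<e e≤w))
  ... | tri≈ _ v≡v′ _ = refl , Axis.pos-inj X v≡v′
  ... | tri> _ _ v′<v = contradiction (least′ v (cv , swap c , v′<v)) (<⇒≱ (<-≤-trans v<e e≤w′))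

  edge-cases : ∀ h v → Edge h v →
    (∃₂ λ g w → Rectangle h v g w) ⊎ ∃ (LastInRow h v) ⊎ ∃ (TopOfColumn h v) ⊎
    ∃ (TopOfNext h v) ⊎ ∃ (EndInStrip left h v) ⊎ ∃ (EndInStrip right h v)
  edge-cases h v e@(r , cv , c@((left≤v , v<right) , (bottom≤h , h<top)))
    with argmin x (Flip.above? C v h)
  ... | inj₁ none = inj₂ (inj₁ (h , refl , r , cv , swap c ,
                      λ { w (cw , cr) → ≮⇒≥ λ v<w → none w (cw , cr , v<w) }))
  ... | inj₂ (w , isAbove@(cw , cr@((bottom′≤h , h<top′) , (left≤w , w<right)) , v<w) , leastW)
    -- The search runs over all rows overlapping the strip, whether or not they cross `v`:
    -- `endInStrip-unique-row` applies minimality to a row that may miss `v`.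
    with argmin y (λ g → T? (R g) ×-dec y h <? y g ×-dec meets? v w g)
  ...   | inj₁ none = inj₂ (inj₂ (inj₁ (v , refl , cv , r , c , λ { g (rg , ((l , u) , _)) →
                        ≮⇒≥ λ h<g → none g (rg , h<g , ≤-trans l (<⇒≤ v<w) , u) })))
  ...   | inj₂ (g , (rg , h<g , lg≤w , v<rg) , lowest)
    with top v ≤? y g
  -- Column `v` ends before reaching `g`. A row crossing `v` above `h` would overlap the strip,
  -- hence be no lower than `g`; so `h` is topmost on `v`.
  ...     | yes top≤g = inj₂ (inj₂ (inj₁ (v , refl , cv , r , c , λ { g′ (rg′ , ((l , u) , (_ , g′<top))) →
                          ≮⇒≥ λ h<g′ → <⇒≱ (<-≤-trans g′<top top≤g)
                            (lowest g′ (rg′ , h<g′ , ≤-trans l (<⇒≤ v<w) , u)) })))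
  ...     | no top≰g with x v <? left g
  ...       | yes v<lg = inj₂ (inj₂ (inj₂ (inj₂ (inj₁
                (g , e , (rg , h<g) , w , (isAbove , leastW) , (v<lg , lg≤w) , lowest)))))
  ...       | no v≮lg with right g ≤? x w
  ...         | yes rg≤w = inj₂ (inj₂ (inj₂ (inj₂ (inj₂
                  (g , e , (rg , h<g) , w , (isAbove , leastW) , (v<rg , rg≤w) , lowest)))))
  ...         | no rg≰w with top w ≤? y g
  -- The same argument for `w` makes `h` topmost on the next column.
  ...           | yes top≤g = inj₂ (inj₂ (inj₂ (inj₁ (w , e , (isAbove , leastW) , r , swap cr ,
                    λ { g′ (rg′ , ((l , u) , (_ , g′<top))) →
                    ≮⇒≥ λ h<g′ → <⇒≱ (<-≤-trans g′<top top≤g)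
                      (lowest g′ (rg′ , h<g′ , l , <-trans v<w u)) }))))
  -- Now `g` crosses both columns. It is next above `h` along `v` because every row crossing `v`
  -- overlaps the strip.
  ...           | no top′≰g = inj₁ (g , w , e ,
                    ((rg , ((≮⇒≥ v≮lg , v<rg) , (≤-trans bottom≤h (<⇒≤ h<g) , ≰⇒> top≰g)) , h<g)
                    , λ { g′ (rg′ , ((l , u) , _) , h<g′) →
                            lowest g′ (rg′ , h<g′ , ≤-trans l (<⇒≤ v<w) , u) })
                    , (isAbove , leastW)
                    , (lg≤w , ≰⇒> rg≰w) , (≤-trans bottom′≤h (<⇒≤ h<g) , ≰⇒> top′≰g))

  ∣R∣ ∣C∣ : ℕ
  ∣R∣ = count (T? ∘ R)
  ∣C∣ = count (T? ∘ C)

  edges≤rectangles : count₂ edge? ≤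
    count₂ (λ h v → Fin.any? λ g → Fin.any? λ w → rectangle? h v g w)
      + (∣R∣ + (∣C∣ + (∣C∣ + (∣R∣ + ∣R∣))))
  edges≤rectangles = begin
    count₂ edge?
      ≤⟨ count₂-mono edge? (rect? ∪? last? ∪? topC? ∪? topN? ∪? endL? ∪? endR?) edge-cases ⟩
    count₂ (rect? ∪? last? ∪? topC? ∪? topN? ∪? endL? ∪? endR?)
      ≤⟨ split rect? (last? ∪? topC? ∪? topN? ∪? endL? ∪? endR?) ≤-refl
          (split last? (topC? ∪? topN? ∪? endL? ∪? endR?) last≤
          (split topC? (topN? ∪? endL? ∪? endR?) topC≤
          (split topN? (endL? ∪? endR?) topN≤
          (split endL? endR? endL≤ endR≤)))) ⟩
    count₂ rect? + (∣R∣ + (∣C∣ + (∣C∣ + (∣R∣ + ∣R∣)))) ∎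
    where
    open ≤-Reasoning
    rect? = λ h v → Fin.any? λ g → Fin.any? λ w → rectangle? h v g w
    last? = λ h v → Fin.any? (lastInRow? h v)
    topC? = λ h v → Fin.any? (topOfColumn? h v)
    topN? = λ h v → Fin.any? (topOfNext? h v)
    endL? = λ h v → Fin.any? (endInStrip? left h v)
    endR? = λ h v → Fin.any? (endInStrip? right h v)

    infixr 1 _∪?_
    _∪?_ : {P Q : Fin a → Fin b → Set} → (∀ i j → Dec (P i j)) → (∀ i j → Dec (Q i j)) →
      ∀ i j → Dec (P i j ⊎ Q i j)
    (P? ∪? Q?) i j = P? i j ⊎-dec Q? i j

    split : {P Q : Fin a → Fin b → Set}
      (P? : ∀ i j → Dec (P i j)) (Q? : ∀ i j → Dec (Q i j)) → ∀ {s t} →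
      count₂ P? ≤ s → count₂ Q? ≤ t → count₂ (P? ∪? Q?) ≤ s + t
    split P? Q? p q = ≤-trans (count₂-⊎ P? Q?) (+-mono-≤ p q)

    last≤ : count₂ last? ≤ ∣R∣
    last≤ = charge lastInRow? (T? ∘ R) (λ { (refl , r , _) → r }) lastInRow-unique
    topC≤ : count₂ topC? ≤ ∣C∣
    topC≤ = charge topOfColumn? (T? ∘ C) (λ { (refl , c , _) → c }) topOfColumn-unique
    topN≤ : count₂ topN? ≤ ∣C∣
    topN≤ = charge topOfNext? (T? ∘ C) (λ { (_ , ((c , _) , _) , _) → c }) topOfNext-unique
    endL≤ : count₂ endL? ≤ ∣R∣
    endL≤ = charge (endInStrip? left) (T? ∘ R) (λ { (_ , (r , _) , _) → r }) (endInStrip-unique left)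
    endR≤ : count₂ endR? ≤ ∣R∣
    endR≤ = charge (endInStrip? right) (T? ∘ R) (λ { (_ , (r , _) , _) → r }) (endInStrip-unique right)

-- Rectangles with a near side.

module NearColumns {a b} (X : Axis a b) (Y : Axis b a) where
  open Axis X using () renaming (pos to x)
  open Grid X Y

  Shared : Fin a → Fin b → Fin a → Fin b → Set
  Shared h v g w = Cross h w × Cross g w × x v < x w

  shared? : ∀ h v g w → Dec (Shared h v g w)
  shared? h v g w = cross? h w ×-dec cross? g w ×-dec x v <? x w

  sharedUpTo? : ∀ h v g w w′ → Dec (Shared h v g w′ × x w′ ≤ x w)
  sharedUpTo? h v g w w′ = shared? h v g w′ ×-dec x w′ ≤? x w

  -- The rank of `w`, itself included, is taken among all columns and not just the sampled ones, so
  -- it does not depend on the random choices.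
  Near : ℕ → Fin a → Fin b → Fin a → Fin b → Set
  Near m h v g w = Shared h v g w × count (sharedUpTo? h v g w) ≤ m

  near? : ∀ m h v g w → Dec (Near m h v g w)
  near? m h v g w = shared? h v g w ×-dec count (sharedUpTo? h v g w) ≤? m

  -- The three factors depend on `C` alone, on `R` alone and on neither. Dependence on `C` is
  -- through the membership of `v` and `w` only, so the expectation over `C` factors.
  NearRectangle : ℕ → (Fin a → Bool) → (Fin b → Bool) → Fin a → Fin b → Fin a → Fin b → Set
  NearRectangle m R C h v g w =
    (T (C v) × T (C w)) × ((T (R h) × Cross h v) × NextRow R h v g) × Near m h v g w

  start? : ∀ (R : Fin a → Bool) h v → Dec (T (R h) × Cross h v)
  start? R h v = T? (R h) ×-dec cross? h v

  startNext? : ∀ (R : Fin a → Bool) h v g → Dec ((T (R h) × Cross h v) × NextRow R h v g)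
  startNext? R h v g = start? R h v ×-dec nextRow? R h v g

  nearRectangle? : ∀ m (R : Fin a → Bool) (C : Fin b → Bool) h v g w → Dec (NearRectangle m R C h v g w)
  nearRectangle? m R C h v g w =
    (T? (C v) ×-dec T? (C w)) ×-dec startNext? R h v g ×-dec near? m h v g w

  anyNearRectangle? : ∀ m (R : Fin a → Bool) (C : Fin b → Bool) h v → Dec (∃₂ λ g w → NearRectangle m R C h v g w)
  anyNearRectangle? m R C h v = Fin.any? λ g → Fin.any? λ w → nearRectangle? m R C h v g w

HasBiclique : ∀ {a b} → ℕ → (Fin a → Fin b → Set) → Set
HasBiclique {a} {b} k Adj = Σ (Fin k → Fin a) λ f → Σ (Fin k → Fin b) λ g →
  Injective _≡_ _≡_ f × Injective _≡_ _≡_ g × (∀ i j → Adj (f i) (g j))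

module _ {a b} (X : Axis a b) (Y : Axis b a) where
  open Axis X using () renaming (pos to x)
  open Axis Y using () renaming (pos to y)
  open Grid X Y
  private
    module Rows    = NearColumns X Y
    module Columns = NearColumns Y X

  -- The rows between h and g which cross both v and w cross every column
  -- between v and w which crosses both h and g.
  rectangle-near : ∀ m → ¬ HasBiclique (suc m) Cross → ∀ {R C h v g w} →
    Sweep.Rectangle X Y R C h v g w →
    Rows.NearRectangle m R C h v g w ⊎ Columns.NearRectangle m C R v h w g
  rectangle-near m noBiclique {R} {C} {h} {v} {g} {w}
    ((r , cv , hv) , nextUp@((rg , gv , h<g) , _) , nextRight@((cw , wh , v<w) , _) , gw)
    with count (Rows.sharedUpTo? h v g w) ≤? m | count (Columns.sharedUpTo? v h w g) ≤? m
  ... | yes near | _ = inj₁ ((cv , cw) , ((r , hv) , nextUp) , (swap wh , gw , v<w) , near)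
  ... | no _ | yes near =
    inj₂ ((r , rg) , ((cv , swap hv) , nextRight) , (swap gv , swap gw , h<g) , near)
  ... | no farRow | no farColumn
    with col , col-inj , cols ← count⇒injection (suc m) (Rows.sharedUpTo? h v g w) (≰⇒> farRow)
       | row , row-inj , rows ← count⇒injection (suc m) (Columns.sharedUpTo? v h w g) (≰⇒> farColumn)
    = contradiction (row , col , (λ {_} {_} → row-inj) , (λ {_} {_} → col-inj) , λ i j → crosses (rows i) (cols j)) noBiclique
    where
    crosses : ∀ {h′ w′} → Columns.Shared v h w h′ × y h′ ≤ y g →
      Rows.Shared h v g w′ × x w′ ≤ x w → Cross h′ w′
    crosses (((_ , left≤v , _) , (_ , _ , w<right) , h<h′) , h′≤g)
            (((_ , bottom≤h , _) , (_ , _ , g<top) , v<w′) , w′≤w) =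
      (≤-trans left≤v (<⇒≤ v<w′) , ≤-<-trans w′≤w w<right) ,
      (≤-trans bottom≤h (<⇒≤ h<h′) , ≤-<-trans h′≤g g<top)

-- Expected numbers of sampled crossings and near rectangles.

module Expectation (p : ℕ) where
  open Sampling p

  *-E-sum : ∀ s {m} n (f : (Fin n → Bool) → Fin m → ℕ) →
    s * E n (λ S → sum (f S)) ≡ sum (λ i → s * E n (λ S → f S i))
  *-E-sum s n f = trans (cong (s *_) (E-sum n f)) (*-distribˡ-sum s (λ i → E n (λ S → f S i)))

  *-E-sum₂ : ∀ s {l m} n (f : (Fin n → Bool) → Fin l → Fin m → ℕ) →
    s * E n (λ S → sum λ i → sum λ j → f S i j) ≡ sum (λ i → sum λ j → s * E n (λ S → f S i j))
  *-E-sum₂ s n f = trans (*-E-sum s n (λ S i → sum (f S i)))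
                         (sum-cong-≗ λ i → *-E-sum s n (λ S → f S i))

  E-size : ∀ n → q * E n (λ S → count (T? ∘ S)) ≡ n * q ^ n
  E-size n = begin
    q * E n (λ S → count (T? ∘ S))                  ≡⟨ *-E-sum q n (λ S i → b2n (S i)) ⟩
    sum (λ (i : Fin n) → q * E n (λ S → b2n (S i))) ≡⟨ sum-cong-≗ (E-∈ n) ⟩
    sum (λ (_ : Fin n) → q ^ n)                     ≡⟨ sum-const n (q ^ n) ⟩
    n * q ^ n                                       ∎
    where open ≡-Reasoning

  module _ {a b} (X : Axis a b) (Y : Axis b a) where
    open Grid X Y

    -- A crossing survives when its row and its column are both chosen, which has probability 1 /
    -- `q` twice over.
    E-edges : q * E a (λ R → q * E b (λ C → count₂ (Sweep.edge? X Y R C)))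
      ≡ (q ^ a * q ^ b) * count₂ cross?
    E-edges = begin
      q * E a (λ R → q * E b (λ C → count₂ (Sweep.edge? X Y R C)))
        ≡⟨ cong (q *_) (E-cong a λ R →
             trans (*-E-sum₂ q b λ C h v → 𝟙 (Sweep.edge? X Y R C h v)) (sum-cong₂ (inner R))) ⟩
      q * E a (λ R → sum λ h → sum λ v → (𝟙 (cross? h v) * q ^ b) * b2n (R h))
        ≡⟨ trans (*-E-sum₂ q a λ R h v → (𝟙 (cross? h v) * q ^ b) * b2n (R h)) (sum-cong₂ outer) ⟩
      sum (λ h → sum λ v → (q ^ a * q ^ b) * 𝟙 (cross? h v))
        ≡⟨ *-distribˡ-sum₂ (q ^ a * q ^ b) (λ h v → 𝟙 (cross? h v)) ⟨
      (q ^ a * q ^ b) * count₂ cross? ∎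
      where
      open ≡-Reasoning
      inner : ∀ R h v → q * E b (λ C → 𝟙 (Sweep.edge? X Y R C h v)) ≡ (𝟙 (cross? h v) * q ^ b) * b2n (R h)
      inner R h v = begin
        q * E b (λ C → 𝟙 (Sweep.edge? X Y R C h v))
          ≡⟨ cong (q *_) (E-cong b λ C → trans
               (𝟙-× (T? (R h)) (T? (C v) ×-dec cross? h v))
               (trans (cong (b2n (R h) *_) (𝟙-× (T? (C v)) (cross? h v)))
                 (rearrange₁ (b2n (R h)) (b2n (C v)) (𝟙 (cross? h v))))) ⟩
        q * E b (λ C → (b2n (R h) * 𝟙 (cross? h v)) * b2n (C v))
          ≡⟨ cong (q *_) (E-* b (b2n (R h) * 𝟙 (cross? h v)) _) ⟩
        q * ((b2n (R h) * 𝟙 (cross? h v)) * E b (λ C → b2n (C v)))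
          ≡⟨ rearrange₂ q (b2n (R h)) (𝟙 (cross? h v)) _ ⟩
        (𝟙 (cross? h v) * (q * E b (λ C → b2n (C v)))) * b2n (R h)
          ≡⟨ cong (λ e → (𝟙 (cross? h v) * e) * b2n (R h)) (E-∈ b v) ⟩
        (𝟙 (cross? h v) * q ^ b) * b2n (R h) ∎
        where
        rearrange₁ : ∀ r c x → r * (c * x) ≡ (r * x) * c
        rearrange₁ = solve-∀
        rearrange₂ : ∀ q r x e → q * ((r * x) * e) ≡ (x * (q * e)) * r
        rearrange₂ = solve-∀
      outer : ∀ h v → q * E a (λ R → (𝟙 (cross? h v) * q ^ b) * b2n (R h)) ≡ (q ^ a * q ^ b) * 𝟙 (cross? h v)
      outer h v = begin
        q * E a (λ R → (𝟙 (cross? h v) * q ^ b) * b2n (R h))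
          ≡⟨ cong (q *_) (E-* a (𝟙 (cross? h v) * q ^ b) (λ R → b2n (R h))) ⟩
        q * ((𝟙 (cross? h v) * q ^ b) * E a (λ R → b2n (R h)))
          ≡⟨ rearrange q (𝟙 (cross? h v)) (q ^ b) _ ⟩
        ((q * E a (λ R → b2n (R h))) * q ^ b) * 𝟙 (cross? h v)
          ≡⟨ cong (λ e → (e * q ^ b) * 𝟙 (cross? h v)) (E-∈ a h) ⟩
        (q ^ a * q ^ b) * 𝟙 (cross? h v) ∎
        where
        rearrange : ∀ q x t e → q * ((x * t) * e) ≡ ((q * e) * t) * x
        rearrange = solve-∀

  module _ {a b} (X : Axis a b) (Y : Axis b a) (m : ℕ) where
    open Grid X Y
    open NearColumns X Y

    -- With `R` fixed, only the choice of `v` and `w` is random. `Near` puts `v` strictly before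
    -- `w`, so they are distinct and `E-∈₂` applies; without `Near` both sides vanish.
    E-nearRectangle : ∀ R h v g w →
      q * q * E b (λ C → 𝟙 (nearRectangle? m R C h v g w))
        ≡ (q ^ b * 𝟙 (startNext? R h v g)) * 𝟙 (near? m h v g w)
    E-nearRectangle R h v g w = begin
      q * q * E b (λ C → 𝟙 (nearRectangle? m R C h v g w))
        ≡⟨ cong (q * q *_) (trans (E-cong b factor) (E-* b (s * t) (λ C → b2n (C v) * b2n (C w)))) ⟩
      q * q * ((s * t) * e)    ≡⟨ rearrange (q * q) s t e ⟩
      ((q * q * e) * s) * t    ≡⟨ evaluate (near? m h v g w) ⟩
      (q ^ b * s) * t          ∎
      where
      open ≡-Reasoning
      s = 𝟙 (startNext? R h v g)
      t = 𝟙 (near? m h v g w)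
      e = E b (λ C → b2n (C v) * b2n (C w))
      rearrange : ∀ c s t e → c * ((s * t) * e) ≡ ((c * e) * s) * t
      rearrange = solve-∀
      factor : ∀ C → 𝟙 (nearRectangle? m R C h v g w) ≡ (s * t) * (b2n (C v) * b2n (C w))
      factor C = begin
        𝟙 (nearRectangle? m R C h v g w)
          ≡⟨ 𝟙-× (T? (C v) ×-dec T? (C w)) (startNext? R h v g ×-dec near? m h v g w) ⟩
        𝟙 (T? (C v) ×-dec T? (C w)) * 𝟙 (startNext? R h v g ×-dec near? m h v g w)
          ≡⟨ cong₂ _*_ (𝟙-× (T? (C v)) (T? (C w))) (𝟙-× (startNext? R h v g) (near? m h v g w)) ⟩
        (b2n (C v) * b2n (C w)) * (s * t)
          ≡⟨ *-comm (b2n (C v) * b2n (C w)) (s * t) ⟩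
        (s * t) * (b2n (C v) * b2n (C w)) ∎
      evaluate : (d : Dec (Near m h v g w)) → ((q * q * e) * s) * 𝟙 d ≡ (q ^ b * s) * 𝟙 d
      evaluate (no _) = trans (*-zeroʳ ((q * q * e) * s)) (sym (*-zeroʳ (q ^ b * s)))
      evaluate (yes ((_ , _ , v<w) , _)) =
        cong (λ e → (e * s) * 1) (E-∈₂ b λ v≡w → <⇒≢ v<w (cong (Axis.pos X) v≡w))

    -- Union bound over `g` and `w`: given `R`, at most one `g` is next above `h` along `v`, and
    -- `count-low-rank` allows at most `m` near columns `w` for it.
    E-anyNearRectangle : ∀ R h v →
      q * q * E b (λ C → 𝟙 (anyNearRectangle? m R C h v))
        ≤ (q ^ b * m) * 𝟙 (start? R h v)
    E-anyNearRectangle R h v = begin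
      q * q * E b (λ C → 𝟙 (anyNearRectangle? m R C h v))
        ≤⟨ *-monoʳ-≤ (q * q) (E-mono b λ C →
             ≤-trans (𝟙-any (λ g → Fin.any? λ w → nearRectangle? m R C h v g w))
                     (sum-mono λ g → 𝟙-any (nearRectangle? m R C h v g))) ⟩
      q * q * E b (λ C → sum λ g → sum λ w → 𝟙 (nearRectangle? m R C h v g w))
        ≡⟨ trans (*-E-sum₂ (q * q) b λ C g w → 𝟙 (nearRectangle? m R C h v g w))
                 (sum-cong₂ λ g w → E-nearRectangle R h v g w) ⟩
      sum (λ g → sum λ w → (q ^ b * 𝟙 (startNext? R h v g)) * 𝟙 (near? m h v g w))
        ≡⟨ sum-cong-≗ (λ g → *-distribˡ-sum (q ^ b * 𝟙 (startNext? R h v g)) (λ w → 𝟙 (near? m h v g w))) ⟨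
      sum (λ g → (q ^ b * 𝟙 (startNext? R h v g)) * count (near? m h v g))
        ≤⟨ sum-mono (λ g → *-monoʳ-≤ (q ^ b * 𝟙 (startNext? R h v g))
             (count-low-rank (Axis.pos X) (shared? h v g) m)) ⟩
      sum (λ g → (q ^ b * 𝟙 (startNext? R h v g)) * m)
        ≡⟨ sum-cong-≗ (λ g → rearrange (q ^ b) (𝟙 (startNext? R h v g)) m) ⟩
      sum (λ g → (q ^ b * m) * 𝟙 (startNext? R h v g))
        ≡⟨ *-distribˡ-sum (q ^ b * m) (λ g → 𝟙 (startNext? R h v g)) ⟨
      (q ^ b * m) * count (startNext? R h v)
        ≤⟨ *-monoʳ-≤ (q ^ b * m) (count-unique (startNext? R h v) (start? R h v)
             (λ g → proj₁) (λ g g′ n n′ → nextRow-unique (proj₂ n) (proj₂ n′))) ⟩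
      (q ^ b * m) * 𝟙 (start? R h v) ∎
      where
      open ≤-Reasoning
      rearrange : ∀ t s m → (t * s) * m ≡ (t * m) * s
      rearrange = solve-∀

    -- Choosing `h` contributes the third factor 1 / `q`, so each crossing accounts for at most `m`
    -- / `q` cubed.
    E-nearRectangles :
      q * E a (λ R → q * q * E b (λ C → count₂ (anyNearRectangle? m R C)))
        ≤ (m * count₂ cross?) * (q ^ a * q ^ b)
    E-nearRectangles = begin
      q * E a (λ R → q * q * E b (λ C → count₂ (anyNearRectangle? m R C)))
        ≤⟨ *-monoʳ-≤ q (E-mono a λ R → ≤-trans
             (≤-reflexive (*-E-sum₂ (q * q) b λ C h v → 𝟙 (anyNearRectangle? m R C h v)))
             (sum-mono λ h → sum-mono λ v → E-anyNearRectangle R h v)) ⟩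
      q * E a (λ R → sum λ h → sum λ v → (q ^ b * m) * 𝟙 (start? R h v))
        ≡⟨ trans (*-E-sum₂ q a λ R h v → (q ^ b * m) * 𝟙 (start? R h v)) (sum-cong₂ outer) ⟩
      sum (λ h → sum λ v → (m * (q ^ a * q ^ b)) * 𝟙 (cross? h v))
        ≡⟨ *-distribˡ-sum₂ (m * (q ^ a * q ^ b)) (λ h v → 𝟙 (cross? h v)) ⟨
      (m * (q ^ a * q ^ b)) * count₂ cross?
        ≡⟨ rearrange m (q ^ a * q ^ b) (count₂ cross?) ⟩
      (m * count₂ cross?) * (q ^ a * q ^ b) ∎
      where
      open ≤-Reasoning
      rearrange : ∀ m t x → (m * t) * x ≡ (m * x) * t
      rearrange = solve-∀
      rearrange₁ : ∀ t r x → t * (r * x) ≡ (t * x) * r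
      rearrange₁ = solve-∀
      rearrange₂ : ∀ q t m x e → q * (((t * m) * x) * e) ≡ (m * ((q * e) * t)) * x
      rearrange₂ = solve-∀
      outer : ∀ h v → q * E a (λ R → (q ^ b * m) * 𝟙 (start? R h v))
        ≡ (m * (q ^ a * q ^ b)) * 𝟙 (cross? h v)
      outer h v = trans (cong (q *_) (trans
          (E-cong a λ R → trans (cong ((q ^ b * m) *_) (𝟙-× (T? (R h)) (cross? h v)))
            (rearrange₁ (q ^ b * m) (b2n (R h)) (𝟙 (cross? h v))))
          (E-* a ((q ^ b * m) * 𝟙 (cross? h v)) (λ R → b2n (R h)))))
        (trans (rearrange₂ q (q ^ b) m (𝟙 (cross? h v)) _)
          (cong (λ e → (m * (e * q ^ b)) * 𝟙 (cross? h v)) (E-∈ a h)))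

-- The bound on crossings without a biclique.

module _ {a b} (X : Axis a b) (Y : Axis b a) (m-1 : ℕ) where
  private
    m = suc m-1
    module Rows    = NearColumns X Y
    module Columns = NearColumns Y X
  open Grid X Y
  -- This makes `q` equal to `4 * m`, by computation since `m` is a successor.
  open Sampling (4 * m ∸ 1)
  open Expectation (4 * m ∸ 1)

  sampled-edges : ¬ HasBiclique (suc m) Cross → ∀ R C →
    count₂ (Sweep.edge? X Y R C) ≤
      count₂ (Rows.anyNearRectangle? m R C) + count₂ (Columns.anyNearRectangle? m C R)
        + (3 * count (T? ∘ R) + 2 * count (T? ∘ C))
  sampled-edges noBiclique R C = begin
    count₂ edge?
      ≤⟨ edges≤rectangles ⟩
    count₂ rectangles? + (∣R∣ + (∣C∣ + (∣C∣ + (∣R∣ + ∣R∣))))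
      ≤⟨ +-mono-≤ near (≤-reflexive (rearrange ∣R∣ ∣C∣)) ⟩
    count₂ near? + count₂ near′? + (3 * ∣R∣ + 2 * ∣C∣) ∎
    where
    open ≤-Reasoning
    open Sweep X Y R C
    rectangles? = λ h v → Fin.any? λ g → Fin.any? λ w → rectangle? h v g w
    near?  = Rows.anyNearRectangle? m R C
    near′? = Columns.anyNearRectangle? m C R
    rearrange : ∀ r c → r + (c + (c + (r + r))) ≡ 3 * r + 2 * c
    rearrange = solve-∀
    split : ∀ h v → ∃₂ (Rectangle h v) →
      ∃₂ (Rows.NearRectangle m R C h v) ⊎ ∃₂ (Columns.NearRectangle m C R v h)
    split h v (g , w , rect) with rectangle-near X Y m noBiclique rect
    ... | inj₁ near = inj₁ (g , w , near)
    ... | inj₂ near = inj₂ (w , g , near)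
    near : count₂ rectangles? ≤ count₂ near? + count₂ near′?
    near = begin
      count₂ rectangles?
        ≤⟨ count₂-mono rectangles? (λ h v → near? h v ⊎-dec near′? v h) split ⟩
      count₂ (λ h v → near? h v ⊎-dec near′? v h)
        ≤⟨ count₂-⊎ near? (λ h v → near′? v h) ⟩
      count₂ near? + count₂ (λ h v → near′? v h)
        ≡⟨ cong (count₂ near? +_) (∑-comm (λ h v → 𝟙 (near′? v h))) ⟩
      count₂ near? + count₂ near′? ∎

  -- Average `sampled-edges` and multiply by the cube of `q`: each kind of near rectangle
  -- contributes `m * count₂ cross?`, while the expected sizes `a` / `q` and `b` / `q` leave a
  -- factor `q * q`.
  expected-edges : ¬ HasBiclique (suc m) Cross →
    q * q * q * E a (λ R → E b λ C → count₂ (Sweep.edge? X Y R C))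
      ≤ (2 * m * count₂ cross? + q * q * (3 * a + 2 * b)) * (q ^ a * q ^ b)
  expected-edges noBiclique = begin
    q * q * q * E a (λ R → E b λ C → count₂ (Sweep.edge? X Y R C))
      ≤⟨ *-monoʳ-≤ (q * q * q) (E-mono a λ R → E-mono b λ C → sampled-edges noBiclique R C) ⟩
    q * q * q * E a (λ R → E b λ C → near R C + near′ R C + (3 * size R + 2 * size C))
      ≡⟨ cong (q * q * q *_) (trans (E-cong a λ R → split-b R) split-a) ⟩
    q * q * q * (N + N′ + (3 * (SR * q ^ b) + 2 * (SC * q ^ a)))
      ≡⟨ rearrange₁ q N N′ SR SC (q ^ a) (q ^ b) ⟩
    q * (q * q * N) + q * (q * q * N′) + q * q * (3 * (q * SR * q ^ b) + 2 * (q * SC * q ^ a))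
      ≡⟨ cong₂ (λ r c → q * (q * q * N) + q * (q * q * N′) + q * q * (3 * (r * q ^ b) + 2 * (c * q ^ a)))
           (E-size a) (E-size b) ⟩
    q * (q * q * N) + q * (q * q * N′) + q * q * (3 * (a * q ^ a * q ^ b) + 2 * (b * q ^ b * q ^ a))
      ≤⟨ +-monoˡ-≤ _ (+-mono-≤ N≤ N′≤) ⟩
    m * count₂ cross? * (q ^ a * q ^ b) + m * count₂ cross? * (q ^ a * q ^ b)
      + q * q * (3 * (a * q ^ a * q ^ b) + 2 * (b * q ^ b * q ^ a))
      ≡⟨ rearrange₂ m (count₂ cross?) (q ^ a) (q ^ b) (q * q) a b ⟩
    (2 * m * count₂ cross? + q * q * (3 * a + 2 * b)) * (q ^ a * q ^ b) ∎
    where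
    open ≤-Reasoning
    size : ∀ {n} → (Fin n → Bool) → ℕ
    size S = count (T? ∘ S)
    near  = λ R C → count₂ (Rows.anyNearRectangle? m R C)
    near′ = λ R C → count₂ (Columns.anyNearRectangle? m C R)
    N  = E a (λ R → E b (near R))
    N′ = E a (λ R → E b (near′ R))
    SR = E a size
    SC = E b size
    split-b : ∀ R → E b (λ C → near R C + near′ R C + (3 * size R + 2 * size C))
      ≡ E b (near R) + E b (near′ R) + (3 * (q ^ b * size R) + 2 * SC)
    split-b R = trans (E-+ b (λ C → near R C + near′ R C) (λ C → 3 * size R + 2 * size C))
      (cong₂ _+_ (E-+ b (near R) (near′ R))
        (trans (E-+ b (λ C → 3 * size R) (λ C → 2 * size C))
          (cong₂ _+_ (trans (E-const b (3 * size R)) (rearrange (size R) (q ^ b))) (E-* b 2 size))))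
      where
      rearrange : ∀ s t → 3 * s * t ≡ 3 * (t * s)
      rearrange = solve-∀
    split-a : E a (λ R → E b (near R) + E b (near′ R) + (3 * (q ^ b * size R) + 2 * SC))
      ≡ N + N′ + (3 * (SR * q ^ b) + 2 * (SC * q ^ a))
    split-a = trans (E-+ a (λ R → E b (near R) + E b (near′ R)) (λ R → 3 * (q ^ b * size R) + 2 * SC))
      (cong₂ _+_ (E-+ a (λ R → E b (near R)) (λ R → E b (near′ R)))
        (trans (E-+ a (λ R → 3 * (q ^ b * size R)) (λ R → 2 * SC))
          (cong₂ _+_
            (trans (E-* a 3 (λ R → q ^ b * size R))
              (cong (3 *_) (trans (E-* a (q ^ b) size) (*-comm (q ^ b) SR))))
            (trans (E-const a (2 * SC)) (*-assoc 2 SC (q ^ a))))))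
    rearrange₁ : ∀ q n n′ r c s t →
      q * q * q * (n + n′ + (3 * (r * t) + 2 * (c * s)))
        ≡ q * (q * q * n) + q * (q * q * n′) + q * q * (3 * (q * r * t) + 2 * (q * c * s))
    rearrange₁ = solve-∀
    rearrange₂ : ∀ m x s t c a b →
      m * x * (s * t) + m * x * (s * t) + c * (3 * (a * s * t) + 2 * (b * t * s))
        ≡ (2 * m * x + c * (3 * a + 2 * b)) * (s * t)
    rearrange₂ = solve-∀
    N≤ : q * (q * q * N) ≤ m * count₂ cross? * (q ^ a * q ^ b)
    N≤ = ≤-trans (≤-reflexive (cong (q *_) (sym (E-* a (q * q) (λ R → E b (near R))))))
                 (E-nearRectangles X Y m)
    N′≤ : q * (q * q * N′) ≤ m * count₂ cross? * (q ^ a * q ^ b)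
    N′≤ = begin
      q * (q * q * N′)
        -- Here the columns play the role of rows, so they must be averaged outermost before the
        -- bound for the reflected grid applies.
        ≡⟨ cong (λ e → q * (q * q * e)) (E-comm a b near′) ⟩
      q * (q * q * E b (λ C → E a (λ R → near′ R C)))
        ≡⟨ cong (q *_) (E-* b (q * q) (λ C → E a (λ R → near′ R C))) ⟨
      q * E b (λ C → q * q * E a (λ R → near′ R C))
        ≤⟨ E-nearRectangles Y X m ⟩
      m * count₂ (Grid.cross? Y X) * (q ^ b * q ^ a)
        ≡⟨ cong₂ (λ x t → m * x * t) transpose (*-comm (q ^ b) (q ^ a)) ⟩
      m * count₂ cross? * (q ^ a * q ^ b) ∎
      where
      transpose : count₂ (Grid.cross? Y X) ≡ count₂ cross?
      transpose = trans (∑-comm (λ v h → 𝟙 (Grid.cross? Y X v h)))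
        (sum-cong₂ λ h v → ≤-antisym (𝟙-mono (Grid.cross? Y X v h) (cross? h v) swap)
                                      (𝟙-mono (cross? h v) (Grid.cross? Y X v h) swap))

  -- After the total weight is cancelled, `q = 4 * m` leaves `4 * m * x` on the left against
  -- `2 * m * x` plus the size term, so half of the left side absorbs the rectangles.
  crossings≤ : ¬ HasBiclique (suc m) Cross → count₂ cross? ≤ 8 * m * (3 * a + 2 * b)
  crossings≤ noBiclique = *-cancelˡ-≤ (2 * m) (+-cancelˡ-≤ (2 * m * x) _ _ (begin
    2 * m * x + 2 * m * x
      ≡⟨ rearrange₁ m x ⟩
    q * x
      ≤⟨ *-cancelʳ-≤ (q * x) (2 * m * x + q * q * (3 * a + 2 * b)) (q ^ a * q ^ b)
           {{m*n≢0 (q ^ a) (q ^ b) {{m^n≢0 q a}} {{m^n≢0 q b}}}} weighted ⟩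
    2 * m * x + q * q * (3 * a + 2 * b)
      ≡⟨ cong (2 * m * x +_) (rearrange₂ m (3 * a + 2 * b)) ⟩
    2 * m * x + 2 * m * (8 * m * (3 * a + 2 * b)) ∎))
    where
    open ≤-Reasoning
    x = count₂ cross?
    edges = λ R → E b (λ C → count₂ (Sweep.edge? X Y R C))
    rearrange₁ : ∀ m x → 2 * m * x + 2 * m * x ≡ 4 * m * x
    rearrange₁ = solve-∀
    rearrange₂ : ∀ m c → 4 * m * (4 * m) * c ≡ 2 * m * (8 * m * c)
    rearrange₂ = solve-∀
    regroup : ∀ q x e → q * x * e ≡ q * (e * x)
    regroup = solve-∀
    weighted : q * x * (q ^ a * q ^ b) ≤ (2 * m * x + q * q * (3 * a + 2 * b)) * (q ^ a * q ^ b)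
    weighted = begin
      q * x * (q ^ a * q ^ b)
        ≡⟨ regroup q x (q ^ a * q ^ b) ⟩
      q * ((q ^ a * q ^ b) * x)
        ≡⟨ cong (q *_) (E-edges X Y) ⟨
      q * (q * E a (λ R → q * edges R))
        ≡⟨ cong (λ e → q * (q * e)) (E-* a q edges) ⟩
      q * (q * (q * E a edges))
        ≡⟨ assoc q (E a edges) ⟩
      q * q * q * E a edges
        ≤⟨ expected-edges noBiclique ⟩
      (2 * m * x + q * q * (3 * a + 2 * b)) * (q ^ a * q ^ b) ∎
      where
      assoc : ∀ q e → q * (q * (q * e)) ≡ q * q * q * e
      assoc = solve-∀

-- From coordinates in a total order to ranks.

module Ranks (C : TotalOrder 0ℓ 0ℓ 0ℓ) where
  open TotalOrder C using (total)
    renaming (Carrier to K; _≤_ to _≼_; trans to ≼-trans; refl to ≼-refl)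

  Represents : ∀ {a b} → Axis a b → (Fin b → K) → (lo hi : Fin a → K) → Set
  Represents X pos lo hi = ∀ h v →
    Axis.Covers X h v ⇔ (lo h ≼ pos v × pos v ≼ hi h)

  -- Distinct points may coincide in the order; such ties are broken by index.
  module _ {a b} (pos : Fin b → K) (lo hi : Fin a → K)
    (pos≼pos? : ∀ v w → Dec (pos v ≼ pos w))
    (lo≼pos? : ∀ h v → Dec (lo h ≼ pos v))
    (pos≼hi? : ∀ h v → Dec (pos v ≼ hi h)) where

    _≺_ : Fin b → Fin b → Set
    v ≺ w = pos v ≼ pos w × (pos w ≼ pos v → v Fin.< w)

    _≺?_ : ∀ v w → Dec (v ≺ w)
    v ≺? w = pos≼pos? v w ×-dec (pos≼pos? w v →-dec (v Fin.<? w))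

    ≺-irrefl : ∀ v → ¬ v ≺ v
    ≺-irrefl v (_ , tie) = Fin.<-irrefl refl (tie ≼-refl)

    ≺-trans : ∀ {u v w} → u ≺ v → v ≺ w → u ≺ w
    ≺-trans (u≼v , uv) (v≼w , vw) = ≼-trans u≼v v≼w , λ w≼u →
      Fin.<-trans (uv (≼-trans v≼w w≼u)) (vw (≼-trans w≼u u≼v))

    ≺-connex : ∀ v w → v ≡ w ⊎ v ≺ w ⊎ w ≺ v
    ≺-connex v w with pos≼pos? v w | pos≼pos? w v | Fin.<-cmp v w
    ... | _       | _       | tri≈ _ v≡w _ = inj₁ v≡w
    ... | yes v≼w | _       | tri< v<w _ _ = inj₂ (inj₁ (v≼w , λ _ → v<w))
    ... | _       | yes w≼v | tri> _ _ w<v = inj₂ (inj₂ (w≼v , λ _ → w<v))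
    ... | yes v≼w | no w⋠v  | tri> _ _ _   = inj₂ (inj₁ (v≼w , λ w≼v → contradiction w≼v w⋠v))
    ... | no v⋠w  | yes w≼v | tri< _ _ _   = inj₂ (inj₂ (w≼v , λ v≼w → contradiction v≼w v⋠w))
    ... | no v⋠w  | no w⋠v  | _            = contradiction (total (pos v) (pos w))
                                                λ { (inj₁ p) → v⋠w p ; (inj₂ p) → w⋠v p }

    rank : Fin b → ℕ
    rank v = count (_≺? v)

    rank-mono : ∀ {v w} → v ≺ w → rank v < rank w
    rank-mono {v} {w} v≺w =
      count-mono-< (_≺? v) (_≺? w) (λ u u≺v → ≺-trans u≺v v≺w) v v≺w (≺-irrefl v)

    rank-injective : ∀ {v w} → rank v ≡ rank w → v ≡ w
    rank-injective {v} {w} eq with ≺-connex v w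
    ... | inj₁ v≡w        = v≡w
    ... | inj₂ (inj₁ v≺w) = contradiction eq (<⇒≢ (rank-mono v≺w))
    ... | inj₂ (inj₂ w≺v) = contradiction (sym eq) (<⇒≢ (rank-mono w≺v))

    -- Both ends are sizes of initial segments of `_≺_`: the points strictly before `lo h`, and the
    -- points not beyond `hi h`.
    axis : Axis a b
    axis = record
      { pos     = rank
      ; pos-inj = rank-injective
      ; lo      = λ h → count (¬? ∘ lo≼pos? h)
      ; hi      = λ h → count (pos≼hi? h)
      }

    -- An initial segment of `_≺_` consists of the points whose rank is below its size. Covering `v`
    -- thus means lying outside the first segment and inside the second.
    axis-represents : Represents axis pos lo hi
    axis-represents h v = mk⇔
      (λ (l , u) → decidable-stable (lo≼pos? h v) (λ lo⋠v → <⇒≱ (before lo⋠v) l) ,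
                   decidable-stable (pos≼hi? h v) (λ v⋠hi → <⇒≱ u (beyond v⋠hi)))
      (λ (l , u) → count-mono (¬? ∘ lo≼pos? h) (_≺? v) (λ w lo⋠w → outside l lo⋠w) ,
                   count-mono-< (_≺? v) (pos≼hi? h) (λ w (w≼v , _) → ≼-trans w≼v u) v u (≺-irrefl v))
      where
      ≼-of-⋠ : ∀ {s t} → ¬ s ≼ t → t ≼ s
      ≼-of-⋠ {s} {t} s⋠t with total s t
      ... | inj₁ s≼t = contradiction s≼t s⋠t
      ... | inj₂ t≼s = t≼s
      outside : ∀ {w} → lo h ≼ pos v → ¬ lo h ≼ pos w → w ≺ v
      outside l lo⋠w = ≼-trans (≼-of-⋠ lo⋠w) l , λ v≼w → contradiction (≼-trans l v≼w) lo⋠w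
      before : ¬ lo h ≼ pos v → rank v < count (¬? ∘ lo≼pos? h)
      before lo⋠v = count-mono-< (_≺? v) (¬? ∘ lo≼pos? h)
        (λ w (w≼v , _) lo≼w → lo⋠v (≼-trans lo≼w w≼v)) v lo⋠v (≺-irrefl v)
      beyond : ¬ pos v ≼ hi h → count (pos≼hi? h) ≤ rank v
      beyond v⋠hi = count-mono (pos≼hi? h) (_≺? v) λ w w≼hi →
        ≼-trans w≼hi (≼-of-⋠ v⋠hi) , λ v≼w → contradiction (≼-trans v≼w w≼hi) v⋠hi

-- Grid representations up to double negation.

-- Finiteness matters: the double negations are discharged one index at a time.
¬¬-sequence : ∀ {n} {P : Fin n → Set} → (∀ i → ¬ ¬ P i) → ¬ ¬ (∀ i → P i)
¬¬-sequence {zero}  p k = k λ ()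
¬¬-sequence {suc n} p k = p zero λ p₀ → ¬¬-sequence (p ∘ suc) λ ps →
  k λ { zero → p₀ ; (suc i) → ps i }

¬¬-decidable : ∀ {a b} (P : Fin a → Fin b → Set) → ¬ ¬ (∀ i j → Dec (P i j))
¬¬-decidable P = ¬¬-sequence λ i → ¬¬-sequence λ j → ¬¬-excluded-middle

IsGrid : ∀ {n} → BipGraph n → Set
IsGrid {n} G = Σ (Axis n n) λ X → Σ (Axis n n) λ Y → ∀ h v → G h v ≡ true ⇔ Grid.Cross X Y h v

-- A total order need not be decidable, but only finitely many of its
-- comparisons matter, and they are jointly decidable up to double negation.
¬¬-isGrid : ∀ {n} {G : BipGraph n} → IsGIG G → ¬ ¬ IsGrid G
¬¬-isGrid (C , hseg , vseg , adj) k =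
  ¬¬-decidable (λ v w → V.x v ≼ V.x w) λ xx? →
  ¬¬-decidable (λ h v → H.x₁ h ≼ V.x v) λ lx? →
  ¬¬-decidable (λ h v → V.x v ≼ H.x₂ h) λ xr? →
  ¬¬-decidable (λ h g → H.y h ≼ H.y g) λ yy? →
  ¬¬-decidable (λ v h → V.y₁ v ≼ H.y h) λ by? →
  ¬¬-decidable (λ v h → H.y h ≼ V.y₂ v) λ yt? →
  let X = axis V.x H.x₁ H.x₂ xx? lx? xr?
      Y = axis H.y V.y₁ V.y₂ yy? by? yt?
      module XR h v = Equivalence (axis-represents V.x H.x₁ H.x₂ xx? lx? xr? h v)
      module YR v h = Equivalence (axis-represents H.y V.y₁ V.y₂ yy? by? yt? v h)
      module A h v = Equivalence (adj h v)
  in k (X , Y , λ h v → mk⇔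
       (λ e → let (inX , inY) = A.to h v e in XR.from h v inX , YR.from v h inY)
       (λ (inX , inY) → A.from h v (XR.to h v inX , YR.to v h inY)))
  where
  open TotalOrder C using () renaming (_≤_ to _≼_)
  open Ranks C
  module H h = Segments.HSeg (hseg h)
  module V v = Segments.VSeg (vseg v)

-- Counting edges as crossings, and the final bound.

edgeCount≡crossings : ∀ {n} (G : BipGraph n) (X Y : Axis n n) →
  (∀ h v → G h v ≡ true ⇔ Grid.Cross X Y h v) → edgeCount G ≡ count₂ (Grid.cross? X Y)
edgeCount≡crossings {n} G X Y adj = begin
  edgeCount G
    ≡⟨ sum-allFin (λ h → ListAction.sum (map (λ v → b2n (G h v)) (allFin n))) ⟩
  sum (λ h → ListAction.sum (map (λ v → b2n (G h v)) (allFin n)))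
    ≡⟨ sum-cong-≗ (λ h → sum-allFin (λ v → b2n (G h v))) ⟩
  sum (λ h → sum λ v → b2n (G h v))
    ≡⟨ sum-cong₂ (λ h v → indicator (G h v) (Grid.cross? X Y h v) (adj h v)) ⟩
  count₂ (Grid.cross? X Y) ∎
  where
  open ≡-Reasoning
  indicator : ∀ {P : Set} β (p? : Dec P) → β ≡ true ⇔ P → b2n β ≡ 𝟙 p?
  indicator true  p? e = sym (𝟙-yes p? (Equivalence.to e refl))
  indicator false (no _)  e = refl
  indicator false (yes p) e with () ← Equivalence.from e p

theorem3 : (k n : ℕ) → 1 ≤ k → 1 ≤ n → (G : BipGraph n) → IsGIG G →
    ¬ ContainsKkk k G → edgeCount G ≤ 54 * n * (k ∸ 1)
theorem3 k n 1≤k _ G gig noKkk =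
  -- An inequality of naturals is decidable, hence stable, so a grid representation may be assumed.
  decidable-stable (edgeCount G ≤? 54 * n * (k ∸ 1)) λ ¬bound →
    ¬¬-isGrid gig λ (X , Y , adj) → ¬bound (bound k 1≤k noKkk X Y adj)
  where
  open ≤-Reasoning
  bound : ∀ k → 1 ≤ k → ¬ ContainsKkk k G → (X Y : Axis n n) →
    (∀ h v → G h v ≡ true ⇔ Grid.Cross X Y h v) → edgeCount G ≤ 54 * n * (k ∸ 1)
  -- For `k = 1` the rate `4 * (k ∸ 1)` would be zero, so this case is direct: a single edge is
  -- already the forbidden subgraph.
  bound (suc zero) _ noEdge X Y adj = begin
    edgeCount G                         ≡⟨ edgeCount≡crossings G X Y adj ⟩
    count₂ (Grid.cross? X Y)            ≤⟨ sum-mono (λ h → count-unique (Grid.cross? X Y h) (no id)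
                                             (λ v → noCross h v) (λ v _ c _ → contradiction c (noCross h v))) ⟩
    sum {n} (λ _ → 0)                   ≡⟨ sum-const n 0 ⟩
    n * 0                               ≡⟨ *-zeroʳ n ⟩
    0                                   ≤⟨ z≤n ⟩
    54 * n * 0                          ∎
    where
    noCross : ∀ h v → ¬ Grid.Cross X Y h v
    noCross h v c = noEdge ((λ _ → h) , (λ _ → v) , const-injective , const-injective ,
                            λ _ _ → Equivalence.from (adj h v) c)
      where
      const-injective : {x : Fin n} → Injective {A = Fin 1} _≡_ _≡_ (λ _ → x)
      const-injective {_} {zero} {zero} _ = refl
  bound (suc (suc m-1)) _ noKkk X Y adj = begin
    edgeCount G                         ≡⟨ edgeCount≡crossings G X Y adj ⟩
    count₂ (Grid.cross? X Y)            ≤⟨ crossings≤ X Y m-1 noBiclique ⟩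
    8 * suc m-1 * (3 * n + 2 * n)       ≡⟨ rearrange (suc m-1) n ⟩
    -- The argument gives 40; the remaining 14 is slack.
    40 * (n * suc m-1)                  ≤⟨ *-monoˡ-≤ (n * suc m-1) (m≤m+n 40 14) ⟩
    54 * (n * suc m-1)                  ≡⟨ *-assoc 54 n (suc m-1) ⟨
    54 * n * suc m-1                    ∎
    where
    rearrange : ∀ m n → 8 * m * (3 * n + 2 * n) ≡ 40 * (n * m)
    rearrange = solve-∀
    noBiclique : ¬ HasBiclique (suc (suc m-1)) (Grid.Cross X Y)
    noBiclique (f , g , f-inj , g-inj , cross) = noKkk
      (f , g , f-inj , g-inj , λ i j → Equivalence.from (adj (f i) (g j)) (cross i j))
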